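{- Let $U$ be a countably infinite universe, $\mathcal{C}=(L_1,L_2,\ldots)$ a countably infinite collection of languages over $U$, let $m^\star(L_i)$ and the orderings $\mathcal{C}'_i$ be as computed by the Procedure described in the context, and fix a non-decreasing $f:\mathbb{N}\to\mathbb{N}$ with $\lim_{t\to\infty}f(t)=\infty$. Then the Algorithm described in the context (with this $f$) non-uniformly generates from $\mathcal{C}$ with generation time $t^\star(L_i)=\max(g(i),m^\star(L_i)+1)$ for every $i$, where $g(i)$ is the smallest $j$ with $f(j)\ge i$; that is, for every $i$, every enumeration of $L_i$, and every $t$ with $|S_t|\ge t^\star(L_i)$, the output $z_t$ belongs to $L_i\setminus S_t$.
   Context: A language is an infinite subset of $U$. A collection is a sequence of languages; repetitions are allowed and entries are distinguished by their index. An enumeration of a language $L$ is a sequence $x_1,x_2,\ldots$ with every $x_t\in L$ and every $x\in L$ equal to some $x_t$. A generating algorithm at each time $t\ge1$ receives $x_1,\ldots,x_t$ and outputs $z_t\in U$; $S_t$ is the set of distinct strings among $x_1,\ldots,x_t$. An algorithm non-uniformly generates from $\mathcal{C}$ with generation times $t(L_i)$ if for every $i$ and every enumeration of $L_i$, $z_t\in L_i\setminus S_t$ whenever $|S_t|\ge t(L_i)$. Procedure. Set $\mathcal{C}'_0=()$. For $i=1,2,3,\ldots$: append the entry $L_i$ at the end of $\mathcal{C}'_{i-1}$ to get $\mathcal{C}'_i=(L'_1,\ldots,L'_i)$ (a permutation of the entries $L_1,\ldots,L_i$), and set $j=i$. Repeat: (1) among all subcollections $\mathcal{D}$ of the entries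 $(L'_1,\ldots,L'_j)$ that include the entry $L'_j$ and satisfy $|\bigcap_{L\in\mathcal{D}}L|<\infty$, let $\mathcal{C}_{\mathrm{chk}}$ be one maximizing $|\bigcap_{L\in\mathcal{D}}L|$ and $m_{\mathrm{chk}}$ this maximum; if no such $\mathcal{D}$ exists, set $\mathcal{C}_{\mathrm{chk}}=()$, $m_{\mathrm{chk}}=0$. (2) If $j\le1$ or $m_{\mathrm{chk}}>m^\star(L'_{j-1})$ (the entry $L'_{j-1}$ has original index $<i$, so its value $m^\star$ is already fixed), stop the loop. (3) Otherwise swap the entries at positions $j-1$ and $j$ in $\mathcal{C}'_i$, set $j\leftarrow j-1$ and return to (1). When the loop stops, set $\mathcal{C}(L_i)=\mathcal{C}_{\mathrm{chk}}$ and $m^\star(L_i)=m_{\mathrm{chk}}$ (these are attached to index $i$). Algorithm (with parameter $f$). At time $t$, run the first $f(t)$ iterations of the Procedure to obtain $\mathcal{C}'_{f(t)}=(L'_1,\ldots,L'_{f(t)})$. Initialize $I_t=()$ and for $j=1,\ldots,f(t)$ in order: if $S_t\subseteq L'_j$ and $|\bigcap_{L\in I_t\cup\{L'_j\}}L|=\infty$, append $L'_j$ to $I_t$. If $I_t$ is empty, output an arbitrary string of $U\setminus S_t$; otherwise output a string of $(\bigcap_{L\in I_t}L)\setminus S_t$. -}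

module Defs where

open import Axiom.ExcludedMiddle using (ExcludedMiddle)
open import Data.Fin.Base using (toℕ)
open import Data.List.Base using (List; []; _∷_; _∷ʳ_; _ʳ++_; length; reverse; filter; deduplicate)
open import Data.List.Membership.Propositional using () renaming (_∈_ to _∈ₗ_)
open import Data.List.Membership.Propositional.Properties using (∈-filter⁺; ∈-filter⁻; ∈-deduplicate⁺; ∈-deduplicate⁻)
open import Data.List.Membership.Propositional.Properties.WithK using (unique∧set⇒bag)
open import Data.List.Relation.Binary.BagAndSetEquality using (∼bag⇒↭)
open import Data.List.Relation.Binary.Permutation.Propositional.Properties using (↭-length)
open import Data.List.Relation.Binary.Sublist.Propositional using ([]; _∷_) renaming (_⊆_ to _⊑_; _∷ʳ_ to skip)
open import Data.List.Relation.Unary.All using (All; []; _∷_)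
open import Data.List.Relation.Unary.Unique.Propositional using (Unique)
open import Data.List.Relation.Unary.Unique.DecPropositional.Properties using (deduplicate-!)
open import Data.Nat.Base using (ℕ; zero; suc; _+_; _⊔_; _≤_; _≥_; z≤n; s≤s)
open import Data.Nat.Properties using (_≟_; _≤?_; _>?_; ≤-refl; ≤-reflexive; ≤-trans; m≤m⊔n; m≤n⊔m; m≤n⇒m<n∨m≡n; ≤-pred)
open import Data.Product.Base using (∃; _×_; _,_; proj₁; proj₂)
open import Data.Sum.Base using (inj₁; inj₂)
open import Data.Unit.Base using (⊤; tt)
open import Data.Vec.Base using (Vec; tabulate; toList)
open import Data.Vec.Membership.Propositional using () renaming (_∈_ to _∈ᵥ_)
open import Data.Vec.Membership.Propositional.Properties using (∈-toList⁺)
open import Function.Base using (_∘_; const)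
open import Function.Bundles using (_⇔_; mk⇔; module Equivalence)
open import Level using (0ℓ)
open import Relation.Binary.PropositionalEquality using (_≡_; refl; sym; trans)
open import Relation.Nullary.Decidable.Core using (Dec; yes; no)
open import Relation.Nullary.Negation.Core using (¬_; contradiction)
open import Relation.Unary using (Pred; Decidable; _∈_; _∉_; _⊆_; _∩_; _∖_)

private
  variable
    U : Set

-- |P| = n.  The elements are listed rather than counted through a bijection
-- with Fin n, because membership proofs need not be unique.
HasSize : Pred U 0ℓ → ℕ → Set
HasSize P n = ∃ λ xs → Unique xs × length xs ≡ n × (∀ x → (x ∈ₗ xs) ⇔ (x ∈ P))

Finite : Pred U 0ℓ → Set
Finite P = ∃ λ n → HasSize P n

Infinite : Pred U 0ℓ → Set
Infinite P = ¬ Finite P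

record Language (U : Set) : Set₁ where
  field
    strings  : Pred U 0ℓ
    infinite : Infinite strings

open Language public

-- Indices start at 0: the language L_i of the text is C (i - 1).  Entries of a
-- collection are represented by their indices, so that two entries with equal
-- languages stay distinct.
Collection : Set → Set₁
Collection U = ℕ → Language U

-- The empty intersection is the whole universe.
⋂ : Collection U → List ℕ → Pred U 0ℓ
⋂ C D x = All (λ k → x ∈ strings (C k)) D

-- Time starts at 1 and positions at 0: x_t of the text is x (t - 1).
IsEnumeration : (ℕ → U) → Language U → Set
IsEnumeration x L = (∀ s → x s ∈ strings L) × (∀ {y} → y ∈ strings L → ∃ λ s → x s ≡ y)

-- x_1, …, x_t
prefix : (ℕ → U) → (t : ℕ) → Vec U t
prefix x t = tabulate (x ∘ toℕ)

-- S_t, as a function of x_1, …, x_t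
seen : ∀ {t} → Vec U t → Pred U 0ℓ
seen xs x = x ∈ᵥ xs

-- A n receives the input available at time t = suc n.
Generator : Set → Set
Generator U = (n : ℕ) → Vec U (suc n) → U

NonUniformlyGenerates : Generator U → Collection U → (ℕ → ℕ) → Set
NonUniformlyGenerates A C τ =
  ∀ i x → IsEnumeration x (C i) →
  ∀ n s → HasSize (seen (prefix x (suc n))) s → s ≥ τ i →
  A n (prefix x (suc n)) ∈ strings (C i) ∖ seen (prefix x (suc n))

-- With es = (L'_1, …, L'_{j-1}) and e = L'_j: D is a subcollection of
-- (L'_1, …, L'_j) that includes L'_j and has an intersection of finite size m.
-- The entries of an ordering have distinct indices, so subcollections are sublists.
Candidate : Collection U → List ℕ → ℕ → List ℕ → ℕ → Set
Candidate C es e D m = D ⊑ (es ∷ʳ e) × e ∈ₗ D × HasSize (⋂ C D) m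

data Check (C : Collection U) (es : List ℕ) (e : ℕ) : Set where
  maximal : ∀ D m → Candidate C es e D m →
            (∀ D′ m′ → Candidate C es e D′ m′ → m′ ≤ m) → Check C es e
  none    : (∀ D m → ¬ Candidate C es e D m) → Check C es e

module _ {C : Collection U} {es : List ℕ} {e : ℕ} where

  Cchk : Check C es e → List ℕ
  Cchk (maximal D _ _ _) = D
  Cchk (none _)          = []

  mchk : Check C es e → ℕ
  mchk (maximal _ m _ _) = m
  mchk (none _)          = 0

-- A resolution of the choice of a maximizing subcollection in (1).
Checker : Collection U → Set
Checker C = ∀ es e → Check C es e

record State : Set where
  constructor state
  field
    order : List ℕ
    sub   : ℕ → List ℕ
    val   : ℕ → ℕ

open State public

update : {A : Set} → (ℕ → A) → ℕ → A → (ℕ → A)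
update h i a k with k ≟ i
... | yes _ = a
... | no  _ = h k

module _ {C : Collection U} (check : Checker C) where

  -- The new entry i is at position j of the ordering  left ʳ++ (i ∷ right);
  -- left holds positions j-1, …, 1 in this (reversed) order.  Moving the head
  -- of left onto right swaps positions j-1 and j.
  loop : (i : ℕ) (left right : List ℕ) (𝒞 : ℕ → List ℕ) (m : ℕ → ℕ) → State
  loop i [] right 𝒞 m =
    state (i ∷ right) (update 𝒞 i (Cchk (check [] i))) (update m i (mchk (check [] i)))
  loop i (p ∷ left) right 𝒞 m with mchk (check (reverse (p ∷ left)) i) >? m p
  ... | yes _ = state ((p ∷ left) ʳ++ (i ∷ right))
                      (update 𝒞 i (Cchk (check (reverse (p ∷ left)) i)))
                      (update m i (mchk (check (reverse (p ∷ left)) i)))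
  ... | no  _ = loop i left (p ∷ right) 𝒞 m

  -- The state after the given number of iterations; values of sub and val at
  -- indices not yet processed are placeholders that are never read.
  run : ℕ → State
  run zero    = state [] (const []) (const 0)
  run (suc i) = loop i (reverse (order (run i))) [] (sub (run i)) (val (run i))

  C′ : ℕ → List ℕ
  C′ n = order (run n)

  𝒞⋆ : ℕ → List ℕ
  𝒞⋆ i = sub (run (suc i)) i

  m⋆ : ℕ → ℕ
  m⋆ i = val (run (suc i)) i

module _ (em : ExcludedMiddle 0ℓ) (C : Collection U) where

  select : ∀ {t} → Vec U t → (I ks : List ℕ) → List ℕ
  select xs I []       = I
  select xs I (k ∷ ks)
    with em {P = (seen xs ⊆ strings (C k)) × Infinite (⋂ C (I ∷ʳ k))}
  ... | yes _ = select xs (I ∷ʳ k) ks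
  ... | no  _ = select xs I ks

ValidOutput : Collection U → Pred U 0ℓ → List ℕ → U → Set
ValidOutput C S []        z = z ∉ S
ValidOutput C S I@(_ ∷ _) z = z ∈ ⋂ C I ∖ S

-- A is an instance of the Algorithm with parameter f, whatever strings it
-- picks among the permitted ones.
FollowsAlgorithm : ExcludedMiddle 0ℓ → {C : Collection U} → Checker C →
                   (ℕ → ℕ) → Generator U → Set
FollowsAlgorithm em {C} check f A =
  ∀ n xs → ValidOutput C (seen xs) (select em C xs [] (C′ check (f (suc n)))) (A n xs)

TendsToInfinity : (ℕ → ℕ) → Set
TendsToInfinity f = ∀ M → ∃ λ N → ∀ t → t ≥ N → f t ≥ M

IsSmallest : Pred ℕ 0ℓ → ℕ → Set
IsSmallest P j = P j × (∀ k → P k → j ≤ k)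

smallest : {P : Pred ℕ 0ℓ} → Decidable P → ∀ n → P n → ∃ (IsSmallest P)
smallest P? zero    p0 = 0 , p0 , λ _ _ → z≤n
smallest P? (suc n) pn with P? 0
... | yes p0 = 0 , p0 , λ _ _ → z≤n
... | no ¬p0 with smallest (P? ∘ suc) n pn
...   | j , pj , min = suc j , pj ,
  λ { zero p0 → contradiction p0 ¬p0 ; (suc k) pk → s≤s (min k pk) }

module _ (f : ℕ → ℕ) (f→∞ : TendsToInfinity f) where

  -- The entry with index i is L_{i+1}, hence the threshold suc i.
  g-smallest : ∀ i → ∃ (IsSmallest (λ j → f j ≥ suc i))
  g-smallest i = smallest (λ j → suc i ≤? f j)
    (proj₁ (f→∞ (suc i))) (proj₂ (f→∞ (suc i)) _ ≤-refl)

  g : ℕ → ℕ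
  g i = proj₁ (g-smallest i)

  t⋆ : {C : Collection U} → Checker C → ℕ → ℕ
  t⋆ check i = g i ⊔ (m⋆ check i + 1)

-- Classically, the choices left open above can always be made: every step (1)
-- has a result, every |S_t| exists, and some generator follows the Algorithm.

HasSize-unique : {P : Pred U 0ℓ} → ∀ {m n} → HasSize P m → HasSize P n → m ≡ n
HasSize-unique (xs , xs! , lx , ex) (ys , ys! , ly , ey) =
  trans (sym lx) (trans (↭-length (∼bag⇒↭ (unique∧set⇒bag xs! ys!
    (λ {x} → mk⇔ (from (ey x) ∘ to (ex x)) (from (ex x) ∘ to (ey x)))))) ly)
  where open Equivalence

HasSize-resp : {P Q : Pred U 0ℓ} → P ⊆ Q → Q ⊆ P → ∀ {n} → HasSize P n → HasSize Q n
HasSize-resp P⊆Q Q⊆P (xs , xs! , l , e) =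
  xs , xs! , l , λ x → mk⇔ (P⊆Q ∘ to (e x)) (from (e x) ∘ Q⊆P)
  where open Equivalence

module Existence (em : ExcludedMiddle 0ℓ) where

  finite : {P : Pred U 0ℓ} (xs : List U) → (∀ {x} → x ∈ P → x ∈ₗ xs) → Finite P
  finite {U = U} {P} xs P⊆xs = length ys , ys , deduplicate-! eq? _ , refl , λ x → mk⇔
    (λ x∈ → proj₂ (∈-filter⁻ P? {xs = xs} (∈-deduplicate⁻ eq? _ x∈)))
    (λ px → ∈-deduplicate⁺ eq? (∈-filter⁺ P? (P⊆xs px) px))
    where
    eq? : (x y : U) → Dec (x ≡ y)
    eq? _ _ = em
    P? : Decidable P
    P? _ = em
    ys : List U
    ys = deduplicate eq? (filter P? xs)

  seen-finite : ∀ {t} (xs : Vec U t) → Finite (seen xs)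
  seen-finite xs = finite (toList xs) ∈-toList⁺

  fresh : {P : Pred U 0ℓ} → Infinite P → ∀ {t} (xs : Vec U t) → ∃ (P ∖ seen xs)
  fresh {P = P} inf xs with em {P = ∃ (P ∖ seen xs)}
  ... | yes x = x
  ... | no ¬x = contradiction (finite (toList xs) (λ px → ∈-toList⁺ (covered px))) inf
    where
    covered : P ⊆ seen xs
    covered {x} px with em {P = x ∈ seen xs}
    ... | yes x∈ = x∈
    ... | no  x∉ = contradiction (x , px , x∉) ¬x

  module _ (C : Collection U) where

    bounded : (P : Pred U 0ℓ) (es : List ℕ) →
              ∃ λ B → ∀ D m → D ⊑ es → HasSize (P ∩ ⋂ C D) m → m ≤ B
    bounded P [] with em {P = Finite (P ∩ ⋂ C [])}
    ... | yes (n , hn) = n , λ { .[] m [] h → ≤-reflexive (HasSize-unique h hn) }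
    ... | no inf       = 0 , λ { .[] m [] h → contradiction (m , h) inf }
    bounded P (e ∷ es) with bounded P es | bounded (P ∩ strings (C e)) es
    ... | B₁ , b₁ | B₂ , b₂ = B₁ ⊔ B₂ , λ where
      D m (skip .e s) h      → ≤-trans (b₁ D m s h) (m≤m⊔n B₁ B₂)
      (e ∷ D) m (refl ∷ s) h → ≤-trans
        (b₂ D m s (HasSize-resp (λ { (p , q ∷ qs) → (p , q) , qs })
                                (λ { ((p , q) , qs) → p , q ∷ qs }) h))
        (m≤n⊔m B₁ B₂)

    largest : (Q : Pred ℕ 0ℓ) → ∃ Q → ∀ B → (∀ m → Q m → m ≤ B) →
              ∃ λ m → Q m × (∀ m′ → Q m′ → m′ ≤ m)
    largest Q (n , qn) zero b with b n qn
    ... | z≤n = 0 , qn , b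
    largest Q q (suc B) b with em {P = Q (suc B)}
    ... | yes qB = suc B , qB , b
    ... | no ¬qB = largest Q q B below
      where
      below : ∀ m → Q m → m ≤ B
      below m qm with m≤n⇒m<n∨m≡n (b m qm)
      ... | inj₁ m<     = ≤-pred m<
      ... | inj₂ refl   = contradiction qm ¬qB

    checker : Checker C
    checker es e with em {P = ∃ λ m → ∃ λ D → Candidate C es e D m}
    ... | no ¬c = none (λ D m c → ¬c (m , D , c))
    ... | yes c with bounded (λ _ → ⊤) (es ∷ʳ e)
    ...   | B , b with largest (λ m → ∃ λ D → Candidate C es e D m) c B
                         (λ { m (D , s , _ , h) → b D m s (HasSize-resp (λ p → tt , p) proj₂ h) })
    ...     | m , (D , c′) , max = maximal D m c′ (λ D′ m′ c″ → max m′ (D′ , c″))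

    select-infinite : ∀ {t} (xs : Vec U t) I ks → Infinite (⋂ C I) →
                      Infinite (⋂ C (select em C xs I ks))
    select-infinite xs I []       inf = inf
    select-infinite xs I (k ∷ ks) inf
      with em {P = (seen xs ⊆ strings (C k)) × Infinite (⋂ C (I ∷ʳ k))}
    ... | yes (_ , inf′) = select-infinite xs (I ∷ʳ k) ks inf′
    ... | no  _          = select-infinite xs I ks inf

    universe-infinite : Infinite (⋂ C [])
    universe-infinite (_ , xs , _ , _ , e) =
      infinite (C 0) (finite xs (λ {x} _ → Equivalence.from (e x) []))

    generator : (check : Checker C) (f : ℕ → ℕ) → ∃ (FollowsAlgorithm em check f)
    generator check f = (λ n xs → proj₁ (z n xs)) , λ n xs → valid _ (proj₂ (z n xs))
      where
      z : ∀ n (xs : Vec U (suc n)) →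
          ∃ (⋂ C (select em C xs [] (C′ check (f (suc n)))) ∖ seen xs)
      z n xs = fresh (select-infinite xs [] (C′ check (f (suc n))) universe-infinite) xs
      valid : ∀ {S x} I → x ∈ ⋂ C I ∖ S → ValidOutput C S I x
      valid []      p = proj₂ p
      valid (_ ∷ _) p = p

-- Call an entry e of an ordering bounded by m if every finite intersection of e
-- with some of the entries preceding it has at most m elements.  At the end of
-- each iteration every entry e of the ordering is bounded by m⋆(e).  For the
-- newly inserted entry this is the maximality in step (1).  An older entry p
-- acquires a new predecessor i only when i is swapped past p, and then step (1)
-- has just found that finite intersections involving both i and p have at most
-- m⋆(p) elements.  Hence, once |S_t| > m⋆(L_i) and L_i has been inserted, adding
-- L_i to the selected entries cannot make the intersection finite, as it contains
-- S_t; so L_i is selected and the output lies in L_i.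
{-# OPTIONS --safe #-}
module Submission where

open import Defs
open import Axiom.ExcludedMiddle using (ExcludedMiddle)
open import Data.Empty using (⊥-elim)
open import Data.Fin.Base using (toℕ)
open import Data.List.Base using (List; []; _∷_; _++_; _∷ʳ_; _ʳ++_; length; reverse; filter; downFrom)
open import Data.List.Membership.DecPropositional using () renaming (_∈?_ to member?)
open import Data.List.Membership.Propositional using () renaming (_∈_ to _∈ₗ_)
open import Data.List.Membership.Propositional.Properties using (∈-filter⁺; ∈-filter⁻; ∈-∃++; ∈-++⁺ˡ; ∈-++⁺ʳ; ∈-downFrom⁺; ∈-downFrom⁻)
open import Data.List.Relation.Binary.Permutation.Propositional using (_↭_; ↭-refl; ↭-sym; ↭-trans; prep)
open import Data.List.Relation.Binary.Permutation.Propositional.Properties using (∈-resp-↭; ↭-length; ↭-reverse; ++↭ʳ++; shift; ∷↭∷ʳ; ++-identityʳ)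
open import Data.List.Relation.Binary.Sublist.Propositional.Properties using () renaming (filter-⊆ to filter-⊑)
open import Data.List.Relation.Binary.Subset.Propositional using () renaming (_⊆_ to _⊆ₗ_)
open import Data.List.Relation.Binary.Subset.Propositional.Properties using (All-resp-⊇; ∷⁺ʳ; ∈-∷⁺ʳ; xs⊆x∷xs; ⊆-reflexive-↭)
open import Data.List.Relation.Unary.All using (All; []; _∷_; lookup) renaming (tabulate to All-tabulate)
open import Data.List.Relation.Unary.All.Properties using () renaming (∷ʳ⁺ to All-∷ʳ⁺)
open import Data.List.Relation.Unary.AllPairs using ([]; _∷_)
open import Data.List.Relation.Unary.Any using (here; there)
open import Data.List.Relation.Unary.Unique.Propositional using (Unique)
open import Data.Nat.Base using (ℕ; zero; suc; _+_; _≤_; _<_; z≤n; s≤s)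
open import Data.Nat.Properties using (_≟_; _>?_; ≤-trans; ≤-reflexive; <⇒≢; ≮⇒≥; ≤⇒≯; m≤n⇒m<n∨m≡n; ≤-pred; m≤m⊔n; m≤n⊔m; +-comm)
open import Data.Product.Base using (_×_; _,_; proj₁; proj₂)
open import Data.Sum.Base using (inj₁; inj₂)
open import Data.Unit.Base using (⊤; tt)
open import Data.Vec.Base using (Vec; toList)
open import Data.Vec.Membership.Propositional.Properties using (∈-toList⁺)
open import Data.Vec.Properties using (length-toList)
open import Data.Vec.Relation.Unary.Any.Properties using (tabulate⁻)
open import Function.Base using (_∘_)
open import Function.Bundles using (_↔_; module Equivalence)
open import Level using (0ℓ)
open import Relation.Binary.PropositionalEquality using (_≡_; _≢_; refl; sym; trans; subst)
open import Relation.Nullary.Decidable.Core using (yes; no)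
open import Relation.Nullary.Negation.Core using (contradiction)
open import Relation.Unary using (Pred; _∈_; _⊆_; _∖_)

private
  variable
    A U : Set

-- Pigeonhole: deleting the head `x` from `ys` still leaves room for the tail, as uniqueness keeps
-- `x` out of the tail.
unique-⊆⇒length≤ : {xs ys : List A} → Unique xs → xs ⊆ₗ ys → length xs ≤ length ys
unique-⊆⇒length≤ [] _ = z≤n
unique-⊆⇒length≤ {xs = x ∷ xs} (x∉xs ∷ xs!) xs⊆ys with ∈-∃++ (xs⊆ys (here refl))
... | as , bs , refl =
  ≤-trans (s≤s (unique-⊆⇒length≤ xs! xs⊆rest)) (≤-reflexive (sym (↭-length (shift x as bs))))
  where
  xs⊆rest : xs ⊆ₗ as ++ bs
  xs⊆rest y∈xs with ∈-resp-↭ (shift x as bs) (xs⊆ys (there y∈xs))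
  ... | here y≡x = contradiction (sym y≡x) (lookup x∉xs y∈xs)
  ... | there y∈ = y∈

HasSize-mono : {P Q : Pred U 0ℓ} {m n : ℕ} → P ⊆ Q → HasSize P m → HasSize Q n → m ≤ n
HasSize-mono P⊆Q (xs , xs! , refl , ex) (ys , _ , refl , ey) =
  unique-⊆⇒length≤ xs! λ {x} → from (ey x) ∘ P⊆Q ∘ to (ex x)
  where open Equivalence

-- Turns a lower bound on |S_t| into one on the time, which decides how many iterations of the
-- Procedure have been run.
seen-size≤ : ∀ {t s} (xs : Vec U t) → HasSize (seen xs) s → s ≤ t
seen-size≤ xs (ys , ys! , refl , e) = ≤-trans
  (unique-⊆⇒length≤ ys! λ {y} → ∈-toList⁺ ∘ Equivalence.to (e y))
  (≤-reflexive (length-toList xs))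

update-same : (h : ℕ → A) (i : ℕ) (a : A) → update h i a i ≡ a
update-same h i a with i ≟ i
... | yes _  = refl
... | no i≢i = contradiction refl i≢i

update-other : (h : ℕ → A) {i k : ℕ} (a : A) → k ≢ i → update h i a k ≡ h k
update-other h {i} {k} a k≢i with k ≟ i
... | yes k≡i = contradiction k≡i k≢i
... | no _    = refl

module _ (C : Collection U) where

  -- Subcollections are taken up to set inclusion instead of as sublists, so that the bound depends
  -- only on the set of predecessors and survives reordering them.
  Bounded : ℕ → List ℕ → ℕ → Set
  Bounded m es e = ∀ D s → D ⊆ₗ e ∷ es → e ∈ₗ D → HasSize (⋂ C D) s → s ≤ m

  -- The first list holds the entries in front of the second one, in any order.
  AllBounded : (ℕ → ℕ) → List ℕ → List ℕ → Set
  AllBounded M pre []       = ⊤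
  AllBounded M pre (e ∷ es) = Bounded (M e) pre e × AllBounded M (e ∷ pre) es

  -- The same for an ordering listed in reverse, as in the second argument of loop.
  AllBoundedʳ : (ℕ → ℕ) → List ℕ → Set
  AllBoundedʳ M []       = ⊤
  AllBoundedʳ M (e ∷ es) = Bounded (M e) es e × AllBoundedʳ M es

module _ {C : Collection U} where

  Bounded-anti : ∀ {m es es′ e} → es′ ⊆ₗ es → Bounded C m es e → Bounded C m es′ e
  Bounded-anti {e = e} es′⊆es b D s D⊆ = b D s (∷⁺ʳ e es′⊆es ∘ D⊆)

  AllBounded-anti : ∀ {M pre pre′} es → pre′ ⊆ₗ pre → AllBounded C M pre es → AllBounded C M pre′ es
  AllBounded-anti []       _        _        = tt
  AllBounded-anti (e ∷ es) pre′⊆pre (b , bs) =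
    Bounded-anti pre′⊆pre b , AllBounded-anti es (∷⁺ʳ e pre′⊆pre) bs

  AllBounded-ʳ++ : ∀ {M} l r → AllBoundedʳ C M l → AllBounded C M l r → AllBounded C M [] (l ʳ++ r)
  AllBounded-ʳ++ []      r _        br = br
  AllBounded-ʳ++ (e ∷ l) r (b , bl) br = AllBounded-ʳ++ l (e ∷ r) bl (b , br)

  AllBoundedʳ-ʳ++ : ∀ {M} r l → AllBounded C M l r → AllBoundedʳ C M l → AllBoundedʳ C M (r ʳ++ l)
  AllBoundedʳ-ʳ++ []      l _        bl = bl
  AllBoundedʳ-ʳ++ (e ∷ r) l (b , br) bl = AllBoundedʳ-ʳ++ r (e ∷ l) br (b , bl)

  -- Filtering `es ∷ʳ e` by membership in `D` yields a sublist with the same members as `D`, hence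
  -- with the same intersection.
  ⊆⇒Candidate : ∀ {es e D s} → D ⊆ₗ e ∷ es → e ∈ₗ D → HasSize (⋂ C D) s →
                       Candidate C es e (filter (λ k → member? _≟_ k D) (es ∷ʳ e)) s
  ⊆⇒Candidate {es} {e} {D} D⊆ e∈D h =
    filter-⊑ ∈D? (es ∷ʳ e) , D⊆D′ e∈D ,
    HasSize-resp (All-resp-⊇ D′⊆D) (All-resp-⊇ D⊆D′) h
    where
    ∈D? = λ k → member? _≟_ k D
    D⊆D′ : D ⊆ₗ filter ∈D? (es ∷ʳ e)
    D⊆D′ k∈D = ∈-filter⁺ ∈D? (∈-resp-↭ (∷↭∷ʳ e es) (D⊆ k∈D)) k∈D
    D′⊆D : filter ∈D? (es ∷ʳ e) ⊆ₗ D
    D′⊆D = proj₂ ∘ ∈-filter⁻ ∈D? {xs = es ∷ʳ e}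

  check-Bounded : ∀ {es e} (c : Check C es e) → Bounded C (mchk c) es e
  check-Bounded (maximal _ _ _ max) D s D⊆ e∈D h = max _ s (⊆⇒Candidate D⊆ e∈D h)
  check-Bounded (none ¬c)           D s D⊆ e∈D h = contradiction (⊆⇒Candidate D⊆ e∈D h) (¬c _ s)

  check-reverse-Bounded : ∀ {es e} (c : Check C (reverse es) e) → Bounded C (mchk c) es e
  check-reverse-Bounded {es} c =
    Bounded-anti (⊆-reflexive-↭ (↭-sym (↭-reverse es))) (check-Bounded c)

  -- A `D` through `i` is covered by the bound for `i` placed behind `p`; a `D` avoiding `i` is
  -- covered by the old bound for `p`.
  Bounded-insert : ∀ {m m′ i p es} → m′ ≤ m →
                   Bounded C m′ (p ∷ es) i → Bounded C m es p → Bounded C m (i ∷ es) p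
  Bounded-insert {i = i} {p} {es} m′≤m bi bp D s D⊆ p∈D h with member? _≟_ i D
  ... | yes i∈D = ≤-trans (bi D s (swap-⊆ ∘ D⊆) i∈D h) m′≤m
    where
    swap-⊆ : p ∷ i ∷ es ⊆ₗ i ∷ p ∷ es
    swap-⊆ = ∈-∷⁺ʳ (there (here refl)) (∷⁺ʳ i (xs⊆x∷xs es p))
  ... | no i∉D = bp D s D⊆p∷es p∈D h
    where
    D⊆p∷es : D ⊆ₗ p ∷ es
    D⊆p∷es k∈D with D⊆ k∈D
    ... | here k≡p           = here k≡p
    ... | there (here refl)  = contradiction k∈D i∉D
    ... | there (there k∈es) = there k∈es

  module _ (check : Checker C) where

    loop-order : ∀ i left right 𝒞 m → order (loop check i left right 𝒞 m) ↭ i ∷ left ++ right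
    loop-order i []         right 𝒞 m = ↭-refl
    loop-order i (p ∷ left) right 𝒞 m with mchk (check (reverse (p ∷ left)) i) >? m p
    ... | yes _ = ↭-trans (↭-sym (++↭ʳ++ (p ∷ left) (i ∷ right))) (shift i (p ∷ left) right)
    ... | no  _ = ↭-trans (loop-order i left (p ∷ right) 𝒞 m) (prep i (shift p left right))

    loop-val : ∀ i left right 𝒞 m {k} → k ≢ i → val (loop check i left right 𝒞 m) k ≡ m k
    loop-val i []         right 𝒞 m k≢i = update-other m _ k≢i
    loop-val i (p ∷ left) right 𝒞 m k≢i with mchk (check (reverse (p ∷ left)) i) >? m p
    ... | yes _ = update-other m _ k≢i
    ... | no  _ = loop-val i left (p ∷ right) 𝒞 m k≢i

    -- `M` stands for the final values: all bounds then refer to one fixed function, although the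
    -- value of `i` is written only when the loop stops. Entries in `right` have been passed and
    -- already count `i` among their predecessors.
    loop-AllBounded : ∀ M i left right 𝒞 m →
      val (loop check i left right 𝒞 m) i ≡ M i → All (λ k → m k ≡ M k) left →
      AllBoundedʳ C M left → AllBounded C M (i ∷ left) right →
      AllBounded C M [] (order (loop check i left right 𝒞 m))
    loop-AllBounded M i [] right 𝒞 m v≡ _ _ br =
      subst (λ v → Bounded C v [] i) (trans (sym (update-same m i _)) v≡)
        (check-Bounded (check [] i)) , br
    loop-AllBounded M i (p ∷ left) right 𝒞 m v≡ (mp≡ ∷ ms≡) bl@(bp , bl′) br
      with mchk (check (reverse (p ∷ left)) i) >? m p
    ... | yes _ = AllBounded-ʳ++ (p ∷ left) (i ∷ right) bl
      ( subst (λ v → Bounded C v (p ∷ left) i) (trans (sym (update-same m i _)) v≡)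
          (check-reverse-Bounded (check (reverse (p ∷ left)) i))
      , br )
    ... | no ¬> = loop-AllBounded M i left (p ∷ right) 𝒞 m v≡ ms≡ bl′
      ( Bounded-insert (≤-trans (≮⇒≥ ¬>) (≤-reflexive mp≡))
          (check-reverse-Bounded (check (reverse (p ∷ left)) i)) bp
      -- The entries of `right` keep the same set of predecessors; only `i` and `p` trade places.
      , AllBounded-anti right (∈-∷⁺ʳ (there (here refl)) (∷⁺ʳ i (xs⊆x∷xs left p))) br )

    C′-↭ : ∀ n → C′ check n ↭ downFrom n
    C′-↭ zero    = ↭-refl
    C′-↭ (suc n) = ↭-trans (loop-order n (reverse (C′ check n)) [] _ _)
      (prep n (↭-trans (++-identityʳ _) (↭-trans (↭-reverse _) (C′-↭ n))))

    -- Each iteration writes only the value of its own index, so the value of `k` is final once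
    -- iteration `k` is done.
    run-val : ∀ n {k} → k < n → val (run check n) k ≡ m⋆ check k
    run-val (suc n) k<1+n with m≤n⇒m<n∨m≡n (≤-pred k<1+n)
    ... | inj₁ k<n  = trans (loop-val n (reverse (C′ check n)) [] _ _ (<⇒≢ k<n)) (run-val n k<n)
    ... | inj₂ refl = refl

    C′-AllBounded : ∀ n → AllBounded C (m⋆ check) [] (C′ check n)
    C′-AllBounded zero    = tt
    C′-AllBounded (suc n) = loop-AllBounded (m⋆ check) n (reverse (C′ check n)) [] _ _ refl
      -- Older entries have indices below `n`, so the values that the loop compares against are
      -- final.
      (All-tabulate λ k∈ → run-val n (∈-downFrom⁻ (∈-resp-↭ (↭-trans (↭-reverse _) (C′-↭ n)) k∈)))
      (AllBoundedʳ-ʳ++ (C′ check n) [] (C′-AllBounded n) tt)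
      tt

  module _ (em : ExcludedMiddle 0ℓ) {t : ℕ} (xs : Vec U t) where

    select-⊇ : ∀ I ks → I ⊆ₗ select em C xs I ks
    select-⊇ I []       k∈I = k∈I
    select-⊇ I (k ∷ ks) k∈I
      with em {P = (seen xs ⊆ strings (C k)) × Infinite (⋂ C (I ∷ʳ k))}
    ... | yes _ = select-⊇ (I ∷ʳ k) ks (∈-++⁺ˡ k∈I)
    ... | no  _ = select-⊇ I ks k∈I

    -- Generalized for induction along the scan: `pre` holds the entries already scanned, among them
    -- the selected ones `I`.
    ∈-select : ∀ {M s i} pre I ks → AllBounded C M pre ks → I ⊆ₗ pre → seen xs ⊆ ⋂ C I →
               HasSize (seen xs) s → seen xs ⊆ strings (C i) → M i < s →
               i ∈ₗ ks → i ∈ₗ select em C xs I ks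
    ∈-select {M} {s} {i} pre I (k ∷ ks) (b , bs) I⊆pre S⊆I hs S⊆i Mi<s i∈
      with em {P = (seen xs ⊆ strings (C k)) × Infinite (⋂ C (I ∷ʳ k))} | i∈
    ... | yes _ | here refl = select-⊇ (I ∷ʳ i) ks (∈-++⁺ʳ I (here refl))
    ... | yes (S⊆k , _) | there i∈ks =
      ∈-select (k ∷ pre) (I ∷ʳ k) ks bs
        (∷⁺ʳ k I⊆pre ∘ ∈-resp-↭ (↭-sym (∷↭∷ʳ k I)))
        (λ x∈ → All-∷ʳ⁺ (S⊆I x∈) (S⊆k x∈)) hs S⊆i Mi<s i∈ks
    ... | no _  | there i∈ks =
      ∈-select (k ∷ pre) I ks bs (there ∘ I⊆pre) S⊆I hs S⊆i Mi<s i∈ks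
    ... | no ¬p | here refl = ⊥-elim (¬p (S⊆i , infinite-∩))
      where
      infinite-∩ : Infinite (⋂ C (I ∷ʳ i))
      -- The intersection over `I ∷ʳ i` contains S_t, so `s ≤ n`; the bound for `i` gives `n ≤ M i`,
      -- against `M i < s`.
      infinite-∩ (n , hn) = ≤⇒≯
        (≤-trans (HasSize-mono (λ x∈ → All-∷ʳ⁺ (S⊆I x∈) (S⊆i x∈)) hs hn)
          (b (I ∷ʳ i) n (∷⁺ʳ i I⊆pre ∘ ∈-resp-↭ (↭-sym (∷↭∷ʳ i I))) (∈-++⁺ʳ I (here refl)) hn))
        Mi<s

  -- Membership of `i` rules out the empty `I`, for which any unseen string is allowed.
  ValidOutput-∈ : ∀ {S i z} I → i ∈ₗ I → ValidOutput C S I z → z ∈ strings (C i) ∖ S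
  ValidOutput-∈ (_ ∷ _) i∈I (z∈ , z∉S) = lookup z∈ i∈I , z∉S

mainTheorem2 : (em : ExcludedMiddle 0ℓ) →
    (U : Set) → ℕ ↔ U →
    (C : Collection U) →
    (check : Checker C) →
    (f : ℕ → ℕ) → (∀ {s t} → s ≤ t → f s ≤ f t) → (f→∞ : TendsToInfinity f) →
    (A : Generator U) → FollowsAlgorithm em check f A →
    NonUniformlyGenerates A C (t⋆ f f→∞ check)
mainTheorem2 em U _ C check f f-mono f→∞ A follows i x (x∈L , _) n s hs s≥t⋆ =
  ValidOutput-∈ (select em C xs [] ks) i∈I (follows n xs)
  where
  xs = prefix x (suc n)
  ks = C′ check (f (suc n))

  S⊆L : seen xs ⊆ strings (C i)
  S⊆L y∈ with tabulate⁻ {f = x ∘ toℕ} y∈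
  ... | _ , refl = x∈L _

  -- Since `g i` is at most `s`, which is at most the time `suc n`, monotonicity carries
  -- `f (g i) ≥ suc i` over to `f (suc n)`.
  i<f : i < f (suc n)
  i<f = ≤-trans (proj₁ (proj₂ (g-smallest f f→∞ i)))
    (f-mono (≤-trans (m≤m⊔n _ (m⋆ check i + 1)) (≤-trans s≥t⋆ (seen-size≤ xs hs))))

  m⋆<s : m⋆ check i < s
  m⋆<s = ≤-trans (≤-reflexive (+-comm 1 (m⋆ check i)))
    (≤-trans (m≤n⊔m (g f f→∞ i) _) s≥t⋆)

  i∈I : i ∈ₗ select em C xs [] ks
  i∈I = ∈-select em xs [] [] ks (C′-AllBounded check (f (suc n))) (λ ()) (λ _ → [])
    hs S⊆L m⋆<s (∈-resp-↭ (↭-sym (C′-↭ check (f (suc n)))) (∈-downFrom⁺ i<f))
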